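{- Let $b$ be a nonzero integer and suppose $0\in\chi(0,b)$. Let $p$ be an odd prime that is a $0$-PL prime relative to $(0,b)$. Then for every integer $q\geq 1$, the wheel graph $W_{q\pi_p(0,b)+1}$ is a $(0,b)$-FLC graph modulo $p$.
   Context: For integers $a,b$, the $(a,b)$-Fibonacci sequence is $F_0=a$, $F_1=b$, $F_n=F_{n-1}+F_{n-2}$ for $n\ge 2$. $(x/p)$ denotes the Legendre symbol for an odd prime $p$ (equal to $0$ when $p\mid x$). The $(a,b)$-Pisano period $\pi_p(a,b)$ is the smallest positive integer $t$ such that $F_{n+t}\equiv F_n \pmod p$ for all $n\ge 0$. For an odd prime $p$ and $j\in\{ -1,0,1\}$, let $\Lambda_j^p(a,b)=\{\xi\in\{0,1,\ldots,\pi_p(a,b)-1\} : (F_\xi/p)=j\}$. The prime $p$ is a $k$-PL prime ($k$-Pisano-Legendre prime) relative to $(a,b)$ if $k=|\Lambda_1^p(a,b)|-|\Lambda_{ -1}^p(a,b)|-|\Lambda_0^p(a,b)|$. The Pisano set $\chi(a,b)$ is the set of all integers $k$ for which there exists an odd prime $p$ that is a $k$-PL prime relative to $(a,b)$. Let $G$ be a simple connected graph of order (number of vertices) $n$. A bijection $f:V(G)\to\{0,1,\ldots,n-1\}$ is an $(a,b)$-FLC labeling (Fibonacci-Legendre cordial labeling) modulo $p$ if the induced edge labeling $f_p^*:E(G)\to\{0,1\}$, given by $f_p^*(uv)=\frac{1+([F_{f(u)}+F_{f(v)}]/p)}{2}$ if $F_{f(u)}+F_{f(v)}\not\equiv 0\pmod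 p$ and $f_p^*(uv)=0$ otherwise, satisfies $|e_{f_p^*}(0)-e_{f_p^*}(1)|\le 1$, where $e_{f_p^*}(i)$ is the number of edges labeled $i$. A graph admitting such a labeling is an $(a,b)$-FLC graph modulo $p$. The cycle graph $C_n$ has vertices $v_1,\ldots,v_n$ and edges $v_iv_{i+1}$ ($1\le i\le n-1$) and $v_1v_n$. The wheel graph $W_n$ of order $n$ is obtained from the cycle $C_{n-1}$ by adding one new vertex $x_0$ adjacent to every vertex of $C_{n-1}$. -}

module Defs where

open import Data.Empty using (⊥)
open import Data.Fin using (Fin; zero; suc; toℕ; _<?_)
open import Data.Fin.Properties using (any?)
import Data.Fin.Properties as Fin
open import Data.Integer using (ℤ; +_; _+_; _-_; _*_; 0ℤ; 1ℤ; -1ℤ; _/_)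
import Data.Integer.Properties as ℤ
open import Data.Integer.Divisibility.Signed using (_∣_; _∣?_)
open import Data.List using (List; length; filter; upTo; allFin; cartesianProduct)
open import Data.Nat as ℕ using (ℕ; zero; suc; ∣_-_∣; _≤_)
import Data.Nat.Properties as ℕ
open import Data.Nat.Primality using (Prime)
open import Data.Product using (_×_; _,_; ∃-syntax)
open import Data.Sum using (_⊎_; swap)
open import Data.Unit using (⊤; tt)
open import Function using (_∘_; _⤖_)
open import Function.Bundles using (module Bijection)
open import Level using (0ℓ)
open import Relation.Binary using (Rel; Decidable; Symmetric; Irreflexive)
open import Relation.Binary.Construct.Closure.ReflexiveTransitive using (Star)
open import Relation.Binary.PropositionalEquality using (_≡_; _≢_; refl; sym)
open import Relation.Nullary using (Dec; yes; no; ¬?)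
open import Relation.Nullary.Decidable using (_×-dec_; _⊎-dec_)
open import Relation.Unary using (Pred)

infix 4 _≡_[mod_]

_≡_[mod_] : ℤ → ℤ → ℕ → Set
x ≡ y [mod p ] = + p ∣ x - y

OddPrime : ℕ → Set
OddPrime p = Prime p × p ≢ 2

F : ℤ → ℤ → ℕ → ℤ
F a b zero          = a
F a b (suc zero)    = b
F a b (suc (suc n)) = F a b (suc n) + F a b n

-- The square root ranges over the residues 0 , … , p - 1.
IsSquareMod : ℤ → ℕ → Set
IsSquareMod x p = ∃[ y ] (+ toℕ {p} y * + toℕ y) ≡ x [mod p ]

isSquareMod? : ∀ x p → Dec (IsSquareMod x p)
isSquareMod? x p = any? λ y → + p ∣? (+ toℕ y * + toℕ y - x)

-- Meaningful for odd primes p.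
legendre : ℤ → ℕ → ℤ
legendre x p with + p ∣? x
... | yes _ = 0ℤ
... | no  _ with isSquareMod? x p
...   | yes _ = 1ℤ
...   | no  _ = -1ℤ

IsPeriod : ℤ → ℤ → ℕ → ℕ → Set
IsPeriod a b p t = 1 ≤ t × (∀ n → F a b (n ℕ.+ t) ≡ F a b n [mod p ])

-- The Pisano period is given by its graph: t = π_p(a,b).
IsPisanoPeriod : ℤ → ℤ → ℕ → ℕ → Set
IsPisanoPeriod a b p t = IsPeriod a b p t × (∀ s → IsPeriod a b p s → t ≤ s)

-- Λ_j^p(a,b), listed without repetition, where t is the Pisano period.
Λ : ℤ → ℤ → (p t : ℕ) → ℤ → List ℕ
Λ a b p t j = filter (λ ξ → legendre (F a b ξ) p ℤ.≟ j) (upTo t)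

∣Λ∣ : ℤ → ℤ → (p t : ℕ) → ℤ → ℤ
∣Λ∣ a b p t j = + length (Λ a b p t j)

IsPLPrime : ℤ → ℤ → ℤ → ℕ → Set
IsPLPrime k a b p = OddPrime p × ∃[ t ]
  (IsPisanoPeriod a b p t ×
   k ≡ ∣Λ∣ a b p t 1ℤ - ∣Λ∣ a b p t -1ℤ - ∣Λ∣ a b p t 0ℤ)

χ : ℤ → ℤ → Pred ℤ 0ℓ
χ a b k = ∃[ p ] IsPLPrime k a b p

record SimpleGraph : Set₁ where
  field
    order  : ℕ
    Adj    : Rel (Fin order) 0ℓ
    adj?   : Decidable Adj
    symm   : Symmetric Adj
    irrefl : Irreflexive _≡_ Adj

  V : Set
  V = Fin order

  -- Each undirected edge appears once, as the pair (u , v) with u < v.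
  edges : List (V × V)
  edges = filter (λ (u , v) → (u <? v) ×-dec adj? u v)
                 (cartesianProduct (allFin order) (allFin order))

  Connected : Set
  Connected = ∀ u v → Star Adj u v

open SimpleGraph public

-- The label set {0, …, n - 1} is Fin n with n = order G.
Labeling : SimpleGraph → Set
Labeling G = V G ⤖ Fin (order G)

module _ (a b : ℤ) (p : ℕ) (G : SimpleGraph) where

  module _ (f : Labeling G) where

    edgeSum : V G × V G → ℤ
    edgeSum (u , v) = F a b (toℕ (to u)) + F a b (toℕ (to v))
      where open Bijection f using (to)

    -- The division is exact: off the first case the Legendre symbol is ±1.
    edgeLabel : V G × V G → ℤ
    edgeLabel e with + p ∣? edgeSum e
    ... | yes _ = 0ℤ
    ... | no  _ = (1ℤ + legendre (edgeSum e) p) / + 2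

    edgeCount : ℤ → ℕ
    edgeCount i = length (filter (λ e → edgeLabel e ℤ.≟ i) (edges G))

    IsFLCLabeling : Set
    IsFLCLabeling = ∣ edgeCount 0ℤ - edgeCount 1ℤ ∣ ≤ 1

  IsFLCGraph : Set
  IsFLCGraph = Connected G × ∃[ f ] IsFLCLabeling f

-- The vertex i : Fin n is v_{i+1}.
CycleEdge : ∀ n → Rel (Fin n) 0ℓ
CycleEdge n i j = suc (toℕ i) ≡ toℕ j ⊎ (toℕ i ≡ 0 × suc (toℕ j) ≡ n)

-- This is C_n for n ≥ 3. The condition i ≢ j only matters for n = 1, where it
-- removes the loop; it makes the definition a simple graph for every n.
cycle : ℕ → SimpleGraph
cycle n = record
  { order  = n
  ; Adj    = λ i j → i ≢ j × (CycleEdge n i j ⊎ CycleEdge n j i)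
  ; adj?   = λ i j → ¬? (i Fin.≟ j) ×-dec (edge? i j ⊎-dec edge? j i)
  ; symm   = λ (i≢j , e) → i≢j ∘ sym , swap e
  ; irrefl = λ i≡j (i≢j , _) → i≢j i≡j
  }
  where
  edge? : Decidable (CycleEdge n)
  edge? i j = (suc (toℕ i) ℕ.≟ toℕ j) ⊎-dec ((toℕ i ℕ.≟ 0) ×-dec (suc (toℕ j) ℕ.≟ n))

module _ (G : SimpleGraph) where

  ConeAdj : Rel (Fin (suc (order G))) 0ℓ
  ConeAdj zero    zero    = ⊥
  ConeAdj zero    (suc _) = ⊤
  ConeAdj (suc _) zero    = ⊤
  ConeAdj (suc i) (suc j) = Adj G i j

  -- G together with a new vertex, zero, adjacent to every vertex of G.
  cone : SimpleGraph
  cone = record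
    { order  = suc (order G)
    ; Adj    = ConeAdj
    ; adj?   = dec
    ; symm   = λ {i} {j} → sm i j
    ; irrefl = λ {i} {j} → irr i j
    }
    where
    dec : Decidable ConeAdj
    dec zero    zero    = no λ ()
    dec zero    (suc _) = yes tt
    dec (suc _) zero    = yes tt
    dec (suc i) (suc j) = adj? G i j

    sm : ∀ i j → ConeAdj i j → ConeAdj j i
    sm zero    (suc _) _ = tt
    sm (suc _) zero    _ = tt
    sm (suc i) (suc j) e = symm G e

    irr : ∀ i j → i ≡ j → ConeAdj i j → ⊥
    irr (suc i) .(suc i) refl e = irrefl G refl e

-- The index is the order of the wheel; order 0 is a junk value.
wheel : ℕ → SimpleGraph
wheel zero    = cycle zero
wheel (suc m) = cone (cycle m)

{-# OPTIONS --safe #-}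

-- Label the hub 0 and the i-th rim vertex i. Since F 0 = 0, the spokes carry
-- the sums F 1 , … , F n, where n = q t; by the recurrence and F n ≡ 0 the rim
-- carries F 2 , … , F (n + 1) modulo p. Both are q full periods, and over one
-- period the two edge labels are balanced because p is a 0-PL prime.
module Submission where

open import Defs
open import Algebra.Bundles using (module AbelianGroup)
import Algebra.Properties.Group as Group
open import Data.Fin using (Fin; zero; suc; toℕ; fromℕ; inject₁; _<_; _<?_)
open import Data.Fin.Properties
  using (toℕ-injective; toℕ-inject₁; toℕ-fromℕ)
open import Data.Integer using (ℤ; 0ℤ; 1ℤ; -1ℤ; +_)
import Data.Integer as ℤ
open import Data.Integer.Divisibility.Signed
  using (_∣_; _∣?_; divides; ∣m∣n⇒∣m+n; ∣m⇒∣-m)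
import Data.Integer.Properties as ℤ
open import Data.Integer.Tactic.RingSolver using (solve-∀)
open import Data.List
  using (List; []; _∷_; _++_; [_]; map; foldr; filter; length; tabulate; applyUpTo; upTo; allFin;
    cartesianProduct)
import Data.List.Membership.Propositional as List
open import Data.List.Membership.Propositional.Properties
  using (∈-++⁺ˡ; ∈-++⁺ʳ; ∈-++⁻; ∈-tabulate⁺; ∈-tabulate⁻; ∈-filter⁺; ∈-filter⁻;
         ∈-cartesianProduct⁺; ∈-allFin)
open import Data.List.Membership.Propositional.Properties.WithK using (unique∧set⇒bag)
open import Data.List.Relation.Binary.BagAndSetEquality using (∼bag⇒↭)
open import Data.List.Relation.Binary.Permutation.Propositional using (_↭_; ↭⇒↭ₛ)
open import Data.List.Relation.Binary.Permutation.Propositional.Properties using (map⁺)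
import Data.List.Relation.Binary.Permutation.Setoid.Properties as Permutation
import Data.List.Relation.Unary.All as All
open import Data.List.Relation.Unary.AllPairs using ([]; _∷_)
open import Data.List.Relation.Unary.Any using (here)
open import Data.List.Relation.Unary.Unique.Propositional using (Unique)
import Data.List.Relation.Unary.Unique.Propositional.Properties as Unique
open import Data.Nat using (ℕ; zero; suc; _+_; _*_; _≤_; z≤n; s≤s)
import Data.Nat as ℕ using (_<_)
import Data.Nat.Properties as ℕ
open import Data.Product using (_×_; _,_; proj₁; proj₂)
open import Data.Sum using (_⊎_; inj₁; inj₂)
open import Data.Unit using (tt)
open import Function using (_∘_; id; mk⇔)
open import Function.Construct.Identity using (⤖-id)
open import Relation.Binary.Construct.Closure.ReflexiveTransitive using (ε; _◅_)
open import Relation.Binary.PropositionalEquality hiding ([_])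
open import Relation.Nullary using (yes; no; contradiction)
open import Relation.Nullary.Decidable using (_×-dec_)
open import Relation.Unary using (_∈_)

private variable
  A : Set

-- Finite sums over lists and over initial segments of the naturals.

∑ : (A → ℤ) → List A → ℤ
∑ f xs = foldr ℤ._+_ 0ℤ (map f xs)

∑-↭ : (f : A → ℤ) {xs ys : List A} → xs ↭ ys → ∑ f xs ≡ ∑ f ys
∑-↭ f xs↭ys = Permutation.foldr-commMonoid (setoid ℤ) ℤ.+-0-isCommutativeMonoid
  (↭⇒↭ₛ (map⁺ f xs↭ys))

∑-++ : (f : A → ℤ) (xs ys : List A) → ∑ f (xs ++ ys) ≡ ∑ f xs ℤ.+ ∑ f ys
∑-++ f []       ys = sym (ℤ.+-identityˡ _)
∑-++ f (x ∷ xs) ys = trans (cong (λ s → f x ℤ.+ s) (∑-++ f xs ys))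
  (sym (ℤ.+-assoc (f x) _ _))

-- Peels off the first term, in step with `tabulate` and `applyUpTo`, so list sums unfold along with
-- it.
∑< : ℕ → (ℕ → ℤ) → ℤ
∑< zero    f = 0ℤ
∑< (suc n) f = f 0 ℤ.+ ∑< n (f ∘ suc)

∑<-cong : ∀ n {f g : ℕ → ℤ} → f ≗ g → ∑< n f ≡ ∑< n g
∑<-cong zero    f≗g = refl
∑<-cong (suc n) f≗g = cong₂ ℤ._+_ (f≗g 0) (∑<-cong n (f≗g ∘ suc))

∑<-last : ∀ n (f : ℕ → ℤ) → ∑< (suc n) f ≡ ∑< n f ℤ.+ f n
∑<-last zero    f = ℤ.+-comm (f 0) 0ℤ
∑<-last (suc n) f = trans (cong (λ s → f 0 ℤ.+ s) (∑<-last n (f ∘ suc)))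
  (sym (ℤ.+-assoc (f 0) _ _))

∑<-+ : ∀ m n (f : ℕ → ℤ) → ∑< (m + n) f ≡ ∑< m f ℤ.+ ∑< n (λ i → f (m + i))
∑<-+ zero    n f = sym (ℤ.+-identityˡ _)
∑<-+ (suc m) n f = trans (cong (λ s → f 0 ℤ.+ s) (∑<-+ m n (f ∘ suc)))
  (sym (ℤ.+-assoc (f 0) _ _))

-- After adding `f 0`, the left side has the terms at `0` to `n`; its last term `f n` may be
-- replaced by `f 0`.
∑<-shift : ∀ n (f : ℕ → ℤ) → f n ≡ f 0 → ∑< n (f ∘ suc) ≡ ∑< n f
∑<-shift n f fn≡f0 = ∙-cancelˡ (f 0) _ _ (begin
  f 0 ℤ.+ ∑< n (f ∘ suc) ≡⟨ ∑<-last n f ⟩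
  ∑< n f ℤ.+ f n         ≡⟨ cong (λ s → ∑< n f ℤ.+ s) fn≡f0 ⟩
  ∑< n f ℤ.+ f 0         ≡⟨ ℤ.+-comm (∑< n f) (f 0) ⟩
  f 0 ℤ.+ ∑< n f         ∎)
  where
  open ≡-Reasoning
  open Group (AbelianGroup.group ℤ.+-0-abelianGroup) using (∙-cancelˡ)

∑-tabulate : ∀ {n} (f : A → ℤ) (k : Fin n → A) (g : ℕ → ℤ) →
  (∀ i → f (k i) ≡ g (toℕ i)) → ∑ f (tabulate k) ≡ ∑< n g
∑-tabulate {n = zero}  f k g f∘k≡g = refl
∑-tabulate {n = suc n} f k g f∘k≡g =
  cong₂ ℤ._+_ (f∘k≡g zero) (∑-tabulate f (k ∘ suc) (g ∘ suc) (f∘k≡g ∘ suc))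

∑-applyUpTo : ∀ (f : A → ℤ) (k : ℕ → A) n → ∑ f (applyUpTo k n) ≡ ∑< n (f ∘ k)
∑-applyUpTo f k zero    = refl
∑-applyUpTo f k (suc n) = cong (λ s → f (k 0) ℤ.+ s) (∑-applyUpTo f (k ∘ suc) n)

-- Sums of periodic functions over whole periods.

module _ {t : ℕ} {f : ℕ → ℤ} (periodic : ∀ i → f (i + t) ≡ f i) where

  periodic-* : ∀ q i → f (i + q * t) ≡ f i
  periodic-* zero    i = cong f (ℕ.+-identityʳ i)
  periodic-* (suc q) i = begin
    f (i + (t + q * t)) ≡⟨ cong f (ℕ.+-assoc i t (q * t)) ⟨
    f (i + t + q * t)   ≡⟨ periodic-* q (i + t) ⟩
    f (i + t)           ≡⟨ periodic i ⟩
    f i                 ∎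
    where open ≡-Reasoning

  ∑<-periods : ∑< t f ≡ 0ℤ → ∀ q → ∑< (q * t) f ≡ 0ℤ
  ∑<-periods ∑≡0 zero    = refl
  ∑<-periods ∑≡0 (suc q) = begin
    ∑< (t + q * t) f
      ≡⟨ ∑<-+ t (q * t) f ⟩
    ∑< t f ℤ.+ ∑< (q * t) (λ i → f (t + i))
      ≡⟨ cong₂ ℤ._+_ ∑≡0 (∑<-cong (q * t) λ i →
           trans (cong f (ℕ.+-comm t i)) (periodic i)) ⟩
    0ℤ ℤ.+ ∑< (q * t) f
      ≡⟨ ℤ.+-identityˡ _ ⟩
    ∑< (q * t) f
      ≡⟨ ∑<-periods ∑≡0 q ⟩
    0ℤ ∎
    where open ≡-Reasoning

-- Differences of counts as sums of signs.

sign : ℤ → ℤ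
sign x with x ℤ.≟ 1ℤ
... | yes _ = 1ℤ
-- The symbol `0` also counts as `-1`: a PL prime subtracts both the non-residues and the zeros, and
-- both give edge label `0`.
... | no  _ = -1ℤ

count : (A → ℤ) → List A → ℤ → ℤ
count f xs j = + length (filter (λ x → f x ℤ.≟ j) xs)

-- Each entry raises exactly one of the three counts, and so moves the difference by its sign. For
-- `upTo t` the left side is the `k` of a `k`-PL prime.
count-legendre : (f : A → ℤ) → (∀ x → f x ≡ 1ℤ ⊎ f x ≡ -1ℤ ⊎ f x ≡ 0ℤ) → ∀ xs →
  count f xs 1ℤ ℤ.- count f xs -1ℤ ℤ.- count f xs 0ℤ ≡ ∑ (sign ∘ f) xs
count-legendre f cases []       = refl
-- With `f x` abstracted, matching on `refl` makes it a constant, and the three filters compute.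
count-legendre f cases (x ∷ xs) with f x | cases x
... | _ | inj₁ refl = trans
  (lemma (count f xs 1ℤ) (count f xs -1ℤ) (count f xs 0ℤ))
  (cong (λ s → 1ℤ ℤ.+ s) (count-legendre f cases xs))
  where
  lemma : ∀ a b c → 1ℤ ℤ.+ a ℤ.- b ℤ.- c ≡ 1ℤ ℤ.+ (a ℤ.- b ℤ.- c)
  lemma = solve-∀
... | _ | inj₂ (inj₁ refl) = trans
  (lemma (count f xs 1ℤ) (count f xs -1ℤ) (count f xs 0ℤ))
  (cong (λ s → -1ℤ ℤ.+ s) (count-legendre f cases xs))
  where
  lemma : ∀ a b c → a ℤ.- (1ℤ ℤ.+ b) ℤ.- c ≡ -1ℤ ℤ.+ (a ℤ.- b ℤ.- c)
  lemma = solve-∀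
... | _ | inj₂ (inj₂ refl) = trans
  (lemma (count f xs 1ℤ) (count f xs -1ℤ) (count f xs 0ℤ))
  (cong (λ s → -1ℤ ℤ.+ s) (count-legendre f cases xs))
  where
  lemma : ∀ a b c → a ℤ.- b ℤ.- (1ℤ ℤ.+ c) ≡ -1ℤ ℤ.+ (a ℤ.- b ℤ.- c)
  lemma = solve-∀

count-label : (f g : A → ℤ) →
  (∀ x → (f x ≡ 1ℤ × g x ≡ 1ℤ) ⊎ (f x ≡ 0ℤ × g x ≡ -1ℤ)) → ∀ xs →
  count f xs 1ℤ ℤ.- count f xs 0ℤ ≡ ∑ g xs
count-label f g cases []       = refl
count-label f g cases (x ∷ xs) with f x | g x | cases x
... | _ | _ | inj₁ (refl , refl) = trans
  (lemma (count f xs 1ℤ) (count f xs 0ℤ))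
  (cong (λ s → 1ℤ ℤ.+ s) (count-label f g cases xs))
  where
  lemma : ∀ a b → 1ℤ ℤ.+ a ℤ.- b ≡ 1ℤ ℤ.+ (a ℤ.- b)
  lemma = solve-∀
... | _ | _ | inj₂ (refl , refl) = trans
  (lemma (count f xs 1ℤ) (count f xs 0ℤ))
  (cong (λ s → -1ℤ ℤ.+ s) (count-label f g cases xs))
  where
  lemma : ∀ a b → a ℤ.- (1ℤ ℤ.+ b) ≡ -1ℤ ℤ.+ (a ℤ.- b)
  lemma = solve-∀

-- Congruences and the Legendre symbol.

≡-mod-sym : ∀ {p} x y → x ≡ y [mod p ] → y ≡ x [mod p ]
≡-mod-sym {p} x y x≡y = subst (+ p ∣_) (lemma x y) (∣m⇒∣-m x≡y)
  where
  lemma : ∀ x y → ℤ.- (x ℤ.- y) ≡ y ℤ.- x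
  lemma = solve-∀

≡-mod-trans : ∀ {p} x y z → x ≡ y [mod p ] → y ≡ z [mod p ] → x ≡ z [mod p ]
≡-mod-trans {p} x y z x≡y y≡z = subst (+ p ∣_) (lemma x y z) (∣m∣n⇒∣m+n x≡y y≡z)
  where
  lemma : ∀ x y z → (x ℤ.- y) ℤ.+ (y ℤ.- z) ≡ x ℤ.- z
  lemma = solve-∀

∣-resp-mod : ∀ {p} x y → x ≡ y [mod p ] → + p ∣ x → + p ∣ y
∣-resp-mod {p} x y x≡y p∣x = subst (+ p ∣_) (lemma x y)
  (∣m∣n⇒∣m+n p∣x (≡-mod-sym x y x≡y))
  where
  lemma : ∀ x y → x ℤ.+ (y ℤ.- x) ≡ y
  lemma = solve-∀

-- Divisibility by `p` and being a square modulo `p` depend only on the residue class.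
legendre-cong : ∀ {p} x y → x ≡ y [mod p ] → legendre x p ≡ legendre y p
legendre-cong {p} x y x≡y with + p ∣? x | + p ∣? y
... | yes _   | yes _   = refl
... | yes p∣x | no  p∤y = contradiction (∣-resp-mod x y x≡y p∣x) p∤y
... | no  p∤x | yes p∣y = contradiction (∣-resp-mod y x (≡-mod-sym x y x≡y) p∣y) p∤x
... | no  _   | no  _ with isSquareMod? x p | isSquareMod? y p
...   | yes _         | yes _         = refl
...   | yes (z , z²≡x) | no  ¬sq      =
  contradiction (z , ≡-mod-trans (+ toℕ z ℤ.* + toℕ z) x y z²≡x x≡y) ¬sq
...   | no  ¬sq       | yes (z , z²≡y) =
  contradiction (z , ≡-mod-trans (+ toℕ z ℤ.* + toℕ z) y x z²≡y (≡-mod-sym x y x≡y)) ¬sq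
...   | no  _         | no  _         = refl

legendre-∣ : ∀ {p x} → + p ∣ x → legendre x p ≡ 0ℤ
legendre-∣ {p} {x} p∣x with + p ∣? x
... | yes _   = refl
... | no  p∤x = contradiction p∣x p∤x

legendre-cases : ∀ p x → legendre x p ≡ 1ℤ ⊎ legendre x p ≡ -1ℤ ⊎ legendre x p ≡ 0ℤ
legendre-cases p x with + p ∣? x
... | yes _ = inj₂ (inj₂ refl)
... | no  _ with isSquareMod? x p
...   | yes _ = inj₁ refl
...   | no  _ = inj₂ (inj₁ refl)

-- Edge labels as signs of edge sums.

edgeLabel-sign : ∀ a b p G f e →
  let l = edgeLabel a b p G f e ; s = sign (legendre (edgeSum a b p G f e) p) in
  (l ≡ 1ℤ × s ≡ 1ℤ) ⊎ (l ≡ 0ℤ × s ≡ -1ℤ)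
edgeLabel-sign a b p G f e with + p ∣? edgeSum a b p G f e
... | yes _ = inj₂ (refl , refl)
-- In this branch `edgeLabel` calls `legendre`, which repeats the divisibility test.
... | no  p∤x with + p ∣? edgeSum a b p G f e
...   | yes p∣x = contradiction p∣x p∤x
...   | no  _ with isSquareMod? (edgeSum a b p G f e) p
...     | yes _ = inj₁ (refl , refl)
...     | no  _ = inj₂ (refl , refl)

-- The sum of signs is the number of edges labelled `1` minus the number labelled `0`, so the two
-- counts are even equal.
balanced⇒IsFLCLabeling : ∀ a b p G f →
  ∑ (λ e → sign (legendre (edgeSum a b p G f e) p)) (edges G) ≡ 0ℤ →
  IsFLCLabeling a b p G f
balanced⇒IsFLCLabeling a b p G f ∑≡0 = subst (_≤ 1) (sym ∣e₀-e₁∣≡0) z≤n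
  where
  e₁≡e₀ : edgeCount a b p G f 1ℤ ≡ edgeCount a b p G f 0ℤ
  e₁≡e₀ = ℤ.+-injective (ℤ.i-j≡0⇒i≡j _ _
    (trans (count-label _ _ (edgeLabel-sign a b p G f) (edges G)) ∑≡0))

  ∣e₀-e₁∣≡0 = ℕ.m≡n⇒∣m-n∣≡0 (sym e₁≡e₀)

-- An explicit edge list for the wheel.

module _ (k : ℕ) where

  private
    -- The rim has `3 + k` vertices, so its closing edge is not already an edge of the path.
    W = wheel (4 + k)

  spoke : Fin (3 + k) → V W × V W
  spoke i = zero , suc i

  step : Fin (2 + k) → V W × V W
  step i = suc (inject₁ i) , suc (suc i)

  -- The smaller endpoint comes first, as in `edges`.
  closing : V W × V W
  closing = suc zero , suc (fromℕ (2 + k))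

  spokes path wheelEdges : List (V W × V W)
  spokes     = tabulate spoke
  path       = tabulate step
  wheelEdges = spokes ++ path ++ [ closing ]

  wheelEdges-unique : Unique wheelEdges
  wheelEdges-unique = Unique.++⁺
    (Unique.tabulate⁺ {f = spoke} λ { refl → refl })
    (Unique.++⁺ (Unique.tabulate⁺ {f = step} λ { refl → refl }) (All.[] ∷ []) closing∉path)
    spokes-disjoint
    where
    closing∉path : ∀ {e} → e List.∈ path × e List.∈ [ closing ] → _
    closing∉path (e∈path , here refl) with ∈-tabulate⁻ {f = step} e∈path
    -- The path edge from the first rim vertex ends at the second, which is not the last.
    ... | zero  , ()
    ... | suc _ , ()

    spokes-disjoint : ∀ {e} → e List.∈ spokes × e List.∈ path ++ [ closing ] → _
    spokes-disjoint (e∈spokes , e∈rim) with ∈-tabulate⁻ {f = spoke} e∈spokes | ∈-++⁻ path e∈rim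
    ... | _ , refl | inj₂ (here ())
    ... | _ , refl | inj₁ e∈path with ∈-tabulate⁻ {f = step} e∈path
    ...   | _ , ()

  path-∈ : ∀ {i j} → suc (toℕ i) ≡ toℕ j → (suc i , suc j) List.∈ path
  path-∈ {i} {suc j} 1+i≡1+j
    with refl ← toℕ-injective (trans (ℕ.suc-injective 1+i≡1+j) (sym (toℕ-inject₁ j)))
    = ∈-tabulate⁺ {f = step} j

  edge⇒∈ : ∀ u v → u < v → Adj W u v → (u , v) List.∈ wheelEdges
  edge⇒∈ zero    (suc j) _ _ = ∈-++⁺ˡ (∈-tabulate⁺ {f = spoke} j)
  edge⇒∈ (suc i) (suc j) _ (_ , inj₁ (inj₁ 1+i≡j)) =
    ∈-++⁺ʳ spokes (∈-++⁺ˡ (path-∈ 1+i≡j))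
  edge⇒∈ (suc i) (suc j) _ (_ , inj₁ (inj₂ (i≡0 , 1+j≡n)))
    with refl ← toℕ-injective {j = zero} i≡0
       | refl ← toℕ-injective (trans (ℕ.suc-injective 1+j≡n) (sym (toℕ-fromℕ (2 + k))))
    = ∈-++⁺ʳ spokes (∈-++⁺ʳ path (here refl))
  -- The two reversed forms of a cycle edge contradict `u < v`.
  edge⇒∈ (suc i) (suc j) (s≤s i<j) (_ , inj₂ (inj₁ 1+j≡i)) =
    contradiction (ℕ.≤-reflexive 1+j≡i) (ℕ.<-asym i<j)
  edge⇒∈ (suc i) (suc j) (s≤s i<j) (_ , inj₂ (inj₂ (j≡0 , _))) =
    contradiction (subst (_ ℕ.<_) j≡0 i<j) λ ()

  ∈⇒edge : ∀ {e} → e List.∈ wheelEdges → proj₁ e < proj₂ e × Adj W (proj₁ e) (proj₂ e)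
  ∈⇒edge e∈ with ∈-++⁻ spokes e∈
  ... | inj₁ e∈spokes with i , refl ← ∈-tabulate⁻ {f = spoke} e∈spokes = s≤s z≤n , tt
  ... | inj₂ e∈rim with ∈-++⁻ path e∈rim
  ...   | inj₂ (here refl) = s≤s (s≤s z≤n) ,
          (λ ()) , inj₁ (inj₂ (refl , cong suc (toℕ-fromℕ (2 + k))))
  ...   | inj₁ e∈path with i , refl ← ∈-tabulate⁻ {f = step} e∈path =
          s≤s i<1+i , (λ eq → ℕ.<⇒≢ i<1+i (cong toℕ eq)) , inj₁ (inj₁ (cong suc (toℕ-inject₁ i)))
    where
    i<1+i : inject₁ i < suc i
    i<1+i = s≤s (ℕ.≤-reflexive (toℕ-inject₁ i))

  -- Both lists are free of repetitions and have the same members, so each is a rearrangement of the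
  -- other.
  edges↭wheelEdges : edges W ↭ wheelEdges
  edges↭wheelEdges = ∼bag⇒↭ (unique∧set⇒bag
    (Unique.filter⁺ edge? (Unique.cartesianProduct⁺ (Unique.allFin⁺ _) (Unique.allFin⁺ _)))
    wheelEdges-unique
    (mk⇔
      (λ e∈ → let u<v , adj = proj₂ (∈-filter⁻ edge? {xs = pairs} e∈) in edge⇒∈ _ _ u<v adj)
      (λ e∈ → ∈-filter⁺ edge? (∈-cartesianProduct⁺ (∈-allFin _) (∈-allFin _)) (∈⇒edge e∈))))
    where
    edge? = λ ((u , v) : V W × V W) → (u <? v) ×-dec adj? W u v
    pairs = cartesianProduct (allFin (order W)) (allFin (order W))

-- The apex is adjacent to every vertex of `G`, so two steps through it suffice.
cone-connected : ∀ G → Connected (cone G)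
cone-connected G zero    zero    = ε
cone-connected G zero    (suc _) = tt ◅ ε
cone-connected G (suc _) zero    = tt ◅ ε
cone-connected G (suc _) (suc _) = _◅_ {j = zero} tt (tt ◅ ε)

-- Fibonacci signs over whole periods and the balance of the wheel.

module _ (b : ℤ) (p t : ℕ) (period : IsPeriod 0ℤ b p t) where

  private
    s : ℕ → ℤ
    s n = sign (legendre (F 0ℤ b n) p)

    s-cong : ∀ x n → x ≡ F 0ℤ b n [mod p ] → sign (legendre x p) ≡ s n
    s-cong x n x≡Fn = cong sign (legendre-cong x (F 0ℤ b n) x≡Fn)

    s-periodic : ∀ i → s (i + t) ≡ s i
    s-periodic i = s-cong (F 0ℤ b (i + t)) i (proj₂ period i)

    F-*-≡0 : ∀ q → F 0ℤ b (q * t) ≡ 0ℤ [mod p ]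
    F-*-≡0 zero    = divides 0ℤ refl
    F-*-≡0 (suc q) = ≡-mod-trans (F 0ℤ b (t + q * t)) (F 0ℤ b (q * t)) 0ℤ
      (subst (λ n → F 0ℤ b n ≡ F 0ℤ b (q * t) [mod p ]) (ℕ.+-comm (q * t) t)
        (proj₂ period (q * t)))
      (F-*-≡0 q)

    s0≡-1 : s 0 ≡ -1ℤ
    s0≡-1 = cong sign (legendre-∣ {p} (divides 0ℤ refl))

  -- Rules out C_1 and C_2, which have no closing edge of their own.
  balanced⇒3≤period : ∑< t s ≡ 0ℤ → 3 ≤ t
  balanced⇒3≤period = go t period
    where
    go : ∀ t → IsPeriod 0ℤ b p t → ∑< t s ≡ 0ℤ → 3 ≤ t
    -- Positivity in `IsPeriod` excludes `t = 0`; for `t = 1` the sum is `s 0`, which is `-1`.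
    go 1 _ ∑≡0 = contradiction
      (trans (sym (cong (ℤ._+ 0ℤ) s0≡-1)) ∑≡0) λ ()
    -- Period 2 gives `b = F 2 ≡ F 0 = 0`, so both signs are `-1` and the sum is `-2`.
    go 2 (_ , F-per) ∑≡0 = contradiction
      (trans (sym (cong₂ (λ x y → x ℤ.+ (y ℤ.+ 0ℤ)) s0≡-1 s1≡-1)) ∑≡0) λ ()
      where
      lemma : ∀ b → b ℤ.+ 0ℤ ℤ.- 0ℤ ≡ b
      lemma = solve-∀

      s1≡-1 : s 1 ≡ -1ℤ
      s1≡-1 = cong sign (legendre-∣ {p} (subst (+ p ∣_) (lemma b) (F-per 0)))
    go (suc (suc (suc _))) _ _ = s≤s (s≤s (s≤s z≤n))

  balanced⇒wheel-FLC : ∑< t s ≡ 0ℤ → ∀ q k → q * t ≡ 3 + k → IsFLCGraph 0ℤ b p (wheel (4 + k))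
  balanced⇒wheel-FLC ∑≡0 q k qt≡n = cone-connected (cycle n) , f ,
    balanced⇒IsFLCLabeling 0ℤ b p W f (begin
      ∑ g (edges W)
        ≡⟨ ∑-↭ g (edges↭wheelEdges k) ⟩
      ∑ g (wheelEdges k)
        ≡⟨ ∑-++ g (spokes k) _ ⟩
      ∑ g (spokes k) ℤ.+ ∑ g (path k ++ [ closing k ])
        ≡⟨ cong₂ ℤ._+_ spokes-sum rim-sum ⟩
      ∑< n (λ i → s (1 + i)) ℤ.+ ∑< n (λ i → s (2 + i))
        ≡⟨ cong₂ ℤ._+_ window₁ window₂ ⟩
      0ℤ ∎)
    where
    open ≡-Reasoning

    n = 3 + k
    W = wheel (4 + k)
    f = ⤖-id (V W)

    g : V W × V W → ℤ
    g e = sign (legendre (edgeSum 0ℤ b p W f e) p)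

    s-periodic-n : ∀ i → s (i + n) ≡ s i
    s-periodic-n i = trans (cong (λ m → s (i + m)) (sym qt≡n)) (periodic-* {f = s} s-periodic q i)

    window₀ : ∑< n s ≡ 0ℤ
    window₀ = subst (λ m → ∑< m s ≡ 0ℤ) qt≡n (∑<-periods {f = s} s-periodic ∑≡0 q)

    -- Moving the window by one place keeps the sum, since `n` is a multiple of the period.
    window₁ : ∑< n (λ i → s (1 + i)) ≡ 0ℤ
    window₁ = trans (∑<-shift n s (s-periodic-n 0)) window₀

    window₂ : ∑< n (λ i → s (2 + i)) ≡ 0ℤ
    window₂ = trans (∑<-shift n (λ i → s (1 + i)) (s-periodic-n 1)) window₁

    spokes-sum : ∑ g (spokes k) ≡ ∑< n (λ i → s (1 + i))
    spokes-sum = ∑-tabulate g (spoke k) (λ i → s (1 + i)) λ i →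
      cong (λ x → sign (legendre x p)) (ℤ.+-identityˡ (F 0ℤ b (suc (toℕ i))))

    path-sum : ∑ g (path k) ≡ ∑< (2 + k) (λ i → s (3 + i))
    path-sum = ∑-tabulate g (step k) (λ i → s (3 + i)) λ i →
      cong (λ x → sign (legendre x p)) (begin
        F 0ℤ b (suc (toℕ (inject₁ i))) ℤ.+ F 0ℤ b (suc (suc (toℕ i)))
          ≡⟨ cong (λ m → F 0ℤ b (suc m) ℤ.+ F 0ℤ b (suc (suc (toℕ i)))) (toℕ-inject₁ i) ⟩
        F 0ℤ b (suc (toℕ i)) ℤ.+ F 0ℤ b (suc (suc (toℕ i)))
          -- Once the summands are swapped, this is the defining recurrence.
          ≡⟨ ℤ.+-comm (F 0ℤ b (suc (toℕ i))) _ ⟩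
        F 0ℤ b (suc (suc (suc (toℕ i)))) ∎)

    -- The endpoints carry `F 1 = b` and `F n ≡ 0`, and `b + 0` is `F 2`.
    closing-sign : g (closing k) ≡ s 2
    closing-sign = s-cong (b ℤ.+ F 0ℤ b (suc (toℕ (fromℕ (2 + k))))) 2
      (subst (+ p ∣_) (lemma b _)
        (subst (λ m → F 0ℤ b m ≡ 0ℤ [mod p ])
          (trans qt≡n (cong suc (sym (toℕ-fromℕ (2 + k))))) (F-*-≡0 q)))
      where
      lemma : ∀ b x → x ℤ.- 0ℤ ≡ (b ℤ.+ x) ℤ.- (b ℤ.+ 0ℤ)
      lemma = solve-∀

    -- The path supplies the indices `3` to `n + 1`; the closing edge supplies the missing index
    -- `2`.
    rim-sum : ∑ g (path k ++ [ closing k ]) ≡ ∑< n (λ i → s (2 + i))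
    rim-sum = begin
      ∑ g (path k ++ [ closing k ])
        ≡⟨ ∑-++ g (path k) _ ⟩
      ∑ g (path k) ℤ.+ (g (closing k) ℤ.+ 0ℤ)
        ≡⟨ cong₂ ℤ._+_ path-sum (trans (ℤ.+-identityʳ _) closing-sign) ⟩
      ∑< (2 + k) (λ i → s (3 + i)) ℤ.+ s 2
        ≡⟨ ℤ.+-comm _ (s 2) ⟩
      ∑< n (λ i → s (2 + i)) ∎

-- From 0-PL primes to wheels.

0-PL⇒balanced : ∀ a b p t →
  0ℤ ≡ ∣Λ∣ a b p t 1ℤ ℤ.- ∣Λ∣ a b p t -1ℤ ℤ.- ∣Λ∣ a b p t 0ℤ →
  ∑< t (λ n → sign (legendre (F a b n) p)) ≡ 0ℤ
0-PL⇒balanced a b p t 0≡k = begin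
  ∑< t (λ n → sign (legendre (F a b n) p))
    ≡⟨ ∑-applyUpTo _ id t ⟨
  ∑ (λ n → sign (legendre (F a b n) p)) (upTo t)
    ≡⟨ count-legendre _ (λ n → legendre-cases p (F a b n)) (upTo t) ⟨
  ∣Λ∣ a b p t 1ℤ ℤ.- ∣Λ∣ a b p t -1ℤ ℤ.- ∣Λ∣ a b p t 0ℤ
    ≡⟨ 0≡k ⟨
  0ℤ ∎
  where open ≡-Reasoning

theorem3p3 : (b : ℤ) → b ≢ 0ℤ → 0ℤ ∈ χ 0ℤ b →
    (p : ℕ) → IsPLPrime 0ℤ 0ℤ b p →
    (t : ℕ) → IsPisanoPeriod 0ℤ b p t →
    (q : ℕ) → 1 ≤ q →
    IsFLCGraph 0ℤ b p (wheel (q * t + 1))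
theorem3p3 b _ _ p (_ , t′ , (period′ , min′) , 0≡k) t (period , min) q@(suc _) _
  -- Both `t′` and `t` are least periods, hence equal.
  with refl ← ℕ.≤-antisym (min t′ period′) (min′ t period)
  with balanced ← 0-PL⇒balanced 0ℤ b p t 0≡k
  -- As `q` is positive, `3 ≤ t ≤ q * t`, which puts the rim length in the form `3 + k`.
  with k , 3+k≡qt ← ℕ.m≤n⇒∃[o]m+o≡n
    (ℕ.≤-trans (balanced⇒3≤period b p t period balanced) (ℕ.m≤n*m t q))
  = subst (IsFLCGraph 0ℤ b p ∘ wheel) (trans (cong suc 3+k≡qt) (ℕ.+-comm 1 (q * t)))
      (balanced⇒wheel-FLC b p t period balanced q k (sym 3+k≡qt))
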